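{- For every numerical semigroup $\Lambda$, \[ c'(\Lambda) \ge \frac{c(\Lambda)}{e(\Lambda)} - \frac{(m(\Lambda)-1)(e(\Lambda)-2)}{2\,e(\Lambda)}. \]
   Context: A numerical semigroup is a subset $\Lambda \subseteq \mathbb{Z}_{\ge 0}$ that contains $0$, is closed under addition, and has finite complement in $\mathbb{Z}_{\ge 0}$. Every numerical semigroup has a unique minimal (with respect to inclusion) generating set, which is finite; its size is the embedding dimension $e(\Lambda)$. The conductor is $c(\Lambda) = \max(\mathbb{Z}_{\ge 0}\setminus\Lambda) + 1$ (with $c(\Lambda)=0$ if $\Lambda = \mathbb{Z}_{\ge 0}$). Define $c'(\Lambda) = |\{\lambda \in \Lambda : \lambda < c(\Lambda)\}|$. The multiplicity is $m(\Lambda) = \min(\Lambda\setminus\{0\})$. -}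

module Defs where

open import Data.Nat.Base
open import Data.Nat.Properties
open import Data.Nat.Induction using (<-rec)
open import Data.List.Base using (List; _∷_; map; filter; length; upTo)
open import Data.List.Extrema.Nat using (max; xs≤max; argmax-sel)
open import Data.List.Membership.Propositional using () renaming (_∈_ to _∈ˡ_; _∉_ to _∉ˡ_)
open import Data.List.Membership.Propositional.Properties
  using (∈-filter⁺; ∈-filter⁻; ∈-upTo⁺; ∈-upTo⁻; ∈-map⁺; ∈-map⁻)
open import Data.List.Membership.DecPropositional _≟_ using () renaming (_∈?_ to _∈ˡ?_)
import Data.List.Relation.Unary.All as All
open import Data.List.Relation.Unary.Unique.Propositional using (Unique)
import Data.List.Relation.Unary.Unique.Propositional.Properties as Unique
open import Data.Product.Base using (∃; _×_; _,_; proj₁; proj₂)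
open import Data.Sum.Base using (inj₁; inj₂)
open import Level using (0ℓ)
open import Relation.Binary.PropositionalEquality
open import Relation.Nullary using (¬_; yes; no; contradiction)
open import Relation.Nullary.Decidable using (¬?; _×-dec_)
open import Relation.Unary using (Pred; Decidable; _∈_; _∉_; _⊆_; _≐_; ∁; _∖_; ｛_｝)

-- The complement is finite in the sense that it is enumerated by a list
-- (repetitions allowed).  Membership in the carrier is then decidable.
record NumericalSemigroup : Set₁ where
  field
    carrier  : Pred ℕ 0ℓ
    0∈       : 0 ∈ carrier
    +-closed : ∀ {a b} → a ∈ carrier → b ∈ carrier → a + b ∈ carrier
    gaps     : List ℕ
    cofinite : carrier ≐ ∁ (_∈ˡ gaps)

  _∈?carrier : Decidable carrier
  n ∈?carrier with n ∈ˡ? gaps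
  ... | yes g = no λ n∈ → proj₁ cofinite n∈ g
  ... | no ¬g = yes (proj₂ cofinite ¬g)

open NumericalSemigroup

data ⟨_⟩ (S : Pred ℕ 0ℓ) : Pred ℕ 0ℓ where
  gen : ∀ {n} → n ∈ S → n ∈ ⟨ S ⟩
  ε   : 0 ∈ ⟨ S ⟩
  _∙_ : ∀ {a b} → a ∈ ⟨ S ⟩ → b ∈ ⟨ S ⟩ → a + b ∈ ⟨ S ⟩

_Generates_ : Pred ℕ 0ℓ → NumericalSemigroup → Set
S Generates Λ = ⟨ S ⟩ ≐ carrier Λ

IsMinimalGeneratingSet : NumericalSemigroup → Pred ℕ 0ℓ → Set₁
IsMinimalGeneratingSet Λ S =
  S Generates Λ × (∀ (T : Pred ℕ 0ℓ) → T ⊆ S → T Generates Λ → S ⊆ T)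

IsLeast : Pred ℕ 0ℓ → ℕ → Set
IsLeast P m = m ∈ P × (∀ {n} → n ∈ P → m ≤ n)

-- For Λ = ℕ the list of gaps is empty and the value is 0.
conductor : NumericalSemigroup → ℕ
conductor Λ = max 0 (map suc (gaps Λ))

conductor≤⇒∈ : ∀ Λ {n} → conductor Λ ≤ n → n ∈ carrier Λ
conductor≤⇒∈ Λ {n} c≤n = proj₂ (cofinite Λ) λ n∈gaps →
  <⇒≱ (All.lookup (xs≤max 0 (map suc (gaps Λ))) (∈-map⁺ suc n∈gaps)) c≤n

conductor-sharp : ∀ Λ {k} → conductor Λ ≡ suc k → k ∉ carrier Λ
conductor-sharp Λ c≡1+k k∈ with argmax-sel (λ n → n) 0 (map suc (gaps Λ))
... | inj₁ c≡0 = contradiction (trans (sym c≡1+k) c≡0) λ ()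
... | inj₂ c∈ with ∈-map⁻ suc c∈
...   | g , g∈ , c≡1+g =
  proj₁ (cofinite Λ) k∈
    (subst (_∈ˡ gaps Λ) (suc-injective (trans (sym c≡1+g) c≡1+k)) g∈)

c′ : NumericalSemigroup → ℕ
c′ Λ = length (filter (_∈?carrier Λ) (upTo (conductor Λ)))

least : ∀ {P : Pred ℕ 0ℓ} → Decidable P → ∀ {n} → n ∈ P → ∃ (IsLeast P)
least {P} P? {n} = <-rec (λ n → n ∈ P → ∃ (IsLeast P)) step n
  where
  step : ∀ n → (∀ {k} → k < n → k ∈ P → ∃ (IsLeast P)) → n ∈ P → ∃ (IsLeast P)
  step n rec n∈P with anyUpTo? P? n
  ... | yes (k , k<n , k∈P) = rec k<n k∈P
  ... | no  ∄k              = n , n∈P , λ {k} k∈P → ≮⇒≥ λ k<n → ∄k (k , k<n , k∈P)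

leastPositive : ∀ Λ → ∃ (IsLeast (carrier Λ ∖ ｛ 0 ｝))
leastPositive Λ =
  least (λ n → (_∈?carrier Λ n) ×-dec ¬? (0 ≟ n))
        (conductor≤⇒∈ Λ (n≤1+n (conductor Λ)) , λ ())

multiplicity : NumericalSemigroup → ℕ
multiplicity Λ = proj₁ (leastPositive Λ)

module _ (Λ : NumericalSemigroup) where
  private
    c : ℕ
    c = conductor Λ

  Reducible : Pred ℕ 0ℓ
  Reducible n = ∃ λ a → a < n × (a ∈ carrier Λ × a ≢ 0 × n ∸ a ∈ carrier Λ)

  reducible? : Decidable Reducible
  reducible? n = anyUpTo?
    (λ a → (_∈?carrier Λ a) ×-dec (¬? (a ≟ 0) ×-dec (_∈?carrier Λ (n ∸ a)))) n

  Irreducible : Pred ℕ 0ℓ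
  Irreducible n = n ∈ carrier Λ × n ≢ 0 × ¬ Reducible n

  irreducible? : Decidable Irreducible
  irreducible? n = (_∈?carrier Λ n) ×-dec (¬? (n ≟ 0) ×-dec ¬? (reducible? n))

  irreducible-< : ∀ {n} → n ∈ Irreducible → n < suc c + suc c
  irreducible-< {n} (_ , _ , irr) = ≰⇒> λ 2+2c≤n → irr
    ( suc c
    , ≤-trans (m<m+n (suc c) z<s) 2+2c≤n
    , conductor≤⇒∈ Λ (n≤1+n c)
    , (λ ())
    , conductor≤⇒∈ Λ (≤-trans (n≤1+n c)
        (subst (_≤ n ∸ suc c) (m+n∸n≡m (suc c) (suc c)) (∸-monoˡ-≤ (suc c) 2+2c≤n)))
    )

  irreducibles : List ℕ
  irreducibles = filter irreducible? (upTo (suc c + suc c))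

  irreducibles-spec : (_∈ˡ irreducibles) ≐ Irreducible
  irreducibles-spec =
    (λ n∈ → proj₂ (∈-filter⁻ irreducible? {xs = upTo (suc c + suc c)} n∈)) ,
    (λ irr → ∈-filter⁺ irreducible? (∈-upTo⁺ (irreducible-< irr)) irr)

  ⟨⟩-least : ∀ {S} → S ⊆ carrier Λ → ⟨ S ⟩ ⊆ carrier Λ
  ⟨⟩-least S⊆Λ (gen s) = S⊆Λ s
  ⟨⟩-least S⊆Λ ε       = 0∈ Λ
  ⟨⟩-least S⊆Λ (p ∙ q) = +-closed Λ (⟨⟩-least S⊆Λ p) (⟨⟩-least S⊆Λ q)

  irreducibles-generate : (_∈ˡ irreducibles) Generates Λ
  irreducibles-generate =
    ⟨⟩-least (λ n∈ → proj₁ (proj₁ irreducibles-spec n∈)) ,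
    (λ {n} → <-rec (λ n → n ∈ carrier Λ → n ∈ ⟨ _∈ˡ irreducibles ⟩) step n)
    where
    step : ∀ n →
           (∀ {k} → k < n → k ∈ carrier Λ → k ∈ ⟨ _∈ˡ irreducibles ⟩) →
           n ∈ carrier Λ → n ∈ ⟨ _∈ˡ irreducibles ⟩
    step zero      rec n∈ = ε
    step n@(suc _) rec n∈ with reducible? n
    ... | no  irr = gen (proj₂ irreducibles-spec (n∈ , (λ ()) , irr))
    ... | yes (zero , _ , _ , a≢0 , _) = contradiction refl a≢0
    ... | yes (a@(suc _) , a<n , a∈ , _ , n∸a∈) =
      subst (_∈ ⟨ _∈ˡ irreducibles ⟩) (m+[n∸m]≡n (<⇒≤ a<n))
        (rec a<n a∈ ∙ rec (∸-monoʳ-< z<s (<⇒≤ a<n)) n∸a∈)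

  irreducible-∈ : ∀ {T} → T ⊆ carrier Λ → ∀ {n} → n ∈ ⟨ T ⟩ → n ∈ Irreducible → n ∈ T
  irreducible-∈ T⊆Λ (gen t) irr = t
  irreducible-∈ T⊆Λ ε (_ , 0≢0 , _) = contradiction refl 0≢0
  irreducible-∈ T⊆Λ (_∙_ {zero} p q) irr = irreducible-∈ T⊆Λ q irr
  irreducible-∈ {T} T⊆Λ (_∙_ {a@(suc _)} {zero} p q) irr =
    subst (_∈ T) (sym (+-identityʳ a))
      (irreducible-∈ T⊆Λ p (subst (_∈ Irreducible) (+-identityʳ a) irr))
  irreducible-∈ T⊆Λ (_∙_ {a@(suc _)} {b@(suc _)} p q) (_ , _ , irr) =
    contradiction
      (a , m<m+n a z<s , ⟨⟩-least T⊆Λ p , (λ ()) ,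
       subst (_∈ carrier Λ) (sym (m+n∸m≡n a b)) (⟨⟩-least T⊆Λ q))
      irr

  irreducibles-⊆ : ∀ (T : Pred ℕ 0ℓ) → T Generates Λ → (_∈ˡ irreducibles) ⊆ T
  irreducibles-⊆ T (⟨T⟩⊆Λ , Λ⊆⟨T⟩) n∈ = irreducible-∈ (λ t → ⟨T⟩⊆Λ (gen t)) (Λ⊆⟨T⟩ (proj₁ irr)) irr
    where irr = proj₁ irreducibles-spec n∈

  minimalGeneratingSet : ∃ λ (gs : List ℕ) → Unique gs × IsMinimalGeneratingSet Λ (_∈ˡ gs)
  minimalGeneratingSet =
    irreducibles ,
    Unique.filter⁺ irreducible? (Unique.upTo⁺ (suc c + suc c)) ,
    irreducibles-generate ,
    (λ T _ → irreducibles-⊆ T)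

  minimalGeneratingSet-unique :
    ∀ (S : Pred ℕ 0ℓ) → IsMinimalGeneratingSet Λ S → S ≐ (_∈ˡ proj₁ minimalGeneratingSet)
  minimalGeneratingSet-unique S (S-gen , S-min) =
    S-min (_∈ˡ irreducibles) (irreducibles-⊆ S S-gen) irreducibles-generate ,
    irreducibles-⊆ S S-gen

  embeddingDimension : ℕ
  embeddingDimension = length (proj₁ minimalGeneratingSet)

embeddingDimension-nonZero : ∀ Λ → NonZero (embeddingDimension Λ)
embeddingDimension-nonZero Λ = nonEmpty (proj₁ (minimalGeneratingSet Λ)) m∈gs
  where
  nonEmpty : ∀ (xs : List ℕ) {x} → x ∈ˡ xs → NonZero (length xs)
  nonEmpty (_ ∷ _) _ = _

  least-irreducible : ∀ {m} → IsLeast (carrier Λ ∖ ｛ 0 ｝) m → m ∈ Irreducible Λ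
  least-irreducible ((m∈ , 0≢m) , m-min) =
    m∈ , ≢-sym 0≢m , λ (a , a<m , a∈ , a≢0 , _) → <⇒≱ a<m (m-min (a∈ , ≢-sym a≢0))

  m∈gs : multiplicity Λ ∈ˡ irreducibles Λ
  m∈gs = proj₂ (irreducibles-spec Λ) (least-irreducible (proj₂ (leastPositive Λ)))

2*embeddingDimension-nonZero : ∀ Λ → NonZero (2 * embeddingDimension Λ)
2*embeddingDimension-nonZero Λ = m*n≢0 2 (embeddingDimension Λ) {{_}} {{embeddingDimension-nonZero Λ}}

{-# OPTIONS --safe #-}

-- Let W = c + m − 1, which bounds the Apéry set Ap of Λ with respect to m.
-- Since |Ap| = m and 2 Σ_{w ∈ Ap} (W − w) = m (2c′ + m − 1) (Selmer), the claim
-- says that m W ≤ e Σ_{w ∈ Ap} (W − w), i.e. that the mean of Ap is at most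
-- (1 − 1/e) W.  For a generator a, count the pairs (n, n + ja) in Ap with j ≥ 1.
-- A given n is the lower member of at most (W − n)/a of them, while a
-- factorization n = Σ x_a a makes it the upper member of at least x_a of them,
-- because Ap is closed under divisors.  So Σ_{n ∈ Ap} n is at most the sum over
-- the generators a of a times the number of pairs, where a = m contributes
-- nothing and each of the e − 1 others at most Σ_{n ∈ Ap} (W − n).
module Submission where

open import Defs
open import Data.Nat.Base as ℕ using (ℕ)
open import Data.Integer.Base as ℤ using (+_)
open import Data.Rational.Base using (_/_; _-_; _≥_)

open import Data.Bool.Base using (if_then_else_)
import Data.Integer.Properties as ℤ
import Data.Integer.Tactic.RingSolver as ℤ-Solver
open import Data.List.Base using (List; []; _∷_; map; filter; length; applyUpTo)
open import Data.List.Membership.Propositional using () renaming (_∈_ to _∈ˡ_)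
open import Data.List.Relation.Unary.All as All using (All; []; _∷_)
open import Data.List.Relation.Unary.Any using (here; there)
open import Data.Nat.Base using
  (zero; suc; pred; NonZero; ≢-nonZero; _+_; _*_; _∸_; _≤_; _<_; z≤n; z<s; s≤s; s<s)
open import Data.Nat.ListAction using (sum)
open import Data.Nat.Properties
open import Data.Nat.Tactic.RingSolver using (solve-∀)
open import Data.Product.Base using (_×_; _,_; proj₁; proj₂)
open import Data.Rational.Base as ℚ using (toℚᵘ)
import Data.Rational.Properties as ℚ
import Data.Rational.Unnormalised.Base as ℚᵘ
import Data.Rational.Unnormalised.Properties as ℚᵘ
open import Data.Sum.Base using (inj₁; inj₂)
open import Function.Base using (_∘_)
open import Level using (0ℓ)
open import Relation.Binary.PropositionalEquality
open import Relation.Nullary using (Dec; does; yes; no; ¬_; contradiction)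
open import Relation.Nullary.Decidable using (¬?; _×-dec_)
open import Relation.Unary using (Pred; Decidable; _∈_)

open import Algebra.Properties.CommutativeSemigroup +-commutativeSemigroup
  using (interchange)
open import Algebra.Properties.CommutativeSemigroup *-commutativeSemigroup
  using (x∙yz≈y∙xz)

-- Indicators of decidable propositions

⟦_⟧ : ∀ {P : Set} → Dec P → ℕ
⟦ P? ⟧ = if does P? then 1 else 0

⟦⟧≤1 : ∀ {P : Set} (P? : Dec P) → ⟦ P? ⟧ ≤ 1
⟦⟧≤1 (yes _) = s≤s z≤n
⟦⟧≤1 (no  _) = z≤n

⟦⟧≡1 : ∀ {P : Set} (P? : Dec P) → P → ⟦ P? ⟧ ≡ 1
⟦⟧≡1 (yes _) p = refl
⟦⟧≡1 (no ¬p) p = contradiction p ¬p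

⟦⟧≡0 : ∀ {P : Set} (P? : Dec P) → ¬ P → ⟦ P? ⟧ ≡ 0
⟦⟧≡0 (yes p) ¬p = contradiction p ¬p
⟦⟧≡0 (no _)  ¬p = refl

⟦⟧-cong : ∀ {P Q : Set} (P? : Dec P) (Q? : Dec Q) → (P → Q) → (Q → P) → ⟦ P? ⟧ ≡ ⟦ Q? ⟧
⟦⟧-cong P? (yes q) P⇒Q Q⇒P = ⟦⟧≡1 P? (Q⇒P q)
⟦⟧-cong P? (no ¬q) P⇒Q Q⇒P = ⟦⟧≡0 P? (¬q ∘ P⇒Q)

⟦⟧≢0 : ∀ {P : Set} (P? : Dec P) → ⟦ P? ⟧ ≢ 0 → P
⟦⟧≢0 (yes p) _   = p
⟦⟧≢0 (no  _) 0≢0 = contradiction refl 0≢0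

⟦⟧-*-monoʳ-≤ : ∀ {P : Set} (P? : Dec P) {x y} → (P → x ≤ y) → ⟦ P? ⟧ * x ≤ ⟦ P? ⟧ * y
⟦⟧-*-monoʳ-≤ (yes p) x≤y = +-monoˡ-≤ 0 (x≤y p)
⟦⟧-*-monoʳ-≤ (no  _) x≤y = z≤n

⟦⟧-*-congʳ : ∀ {P : Set} (P? : Dec P) {x y} → (P → x ≡ y) → ⟦ P? ⟧ * x ≡ ⟦ P? ⟧ * y
⟦⟧-*-congʳ (yes p) x≡y = cong (_+ 0) (x≡y p)
⟦⟧-*-congʳ (no  _) x≡y = refl

-- Finite sums

∑< : ℕ → (ℕ → ℕ) → ℕ
∑< zero    f = 0
∑< (suc n) f = f 0 + ∑< n (f ∘ suc)

infixl 10 ∑<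
syntax ∑< n (λ i → x) = ∑[ i < n ] x

∑-cong : ∀ n {f g : ℕ → ℕ} → (∀ i → i < n → f i ≡ g i) → ∑< n f ≡ ∑< n g
∑-cong zero    f≡g = refl
∑-cong (suc n) f≡g = cong₂ _+_ (f≡g 0 z<s) (∑-cong n (λ i i<n → f≡g (suc i) (s<s i<n)))

∑-mono : ∀ n {f g : ℕ → ℕ} → (∀ i → i < n → f i ≤ g i) → ∑< n f ≤ ∑< n g
∑-mono zero    f≤g = z≤n
∑-mono (suc n) f≤g = +-mono-≤ (f≤g 0 z<s) (∑-mono n (λ i i<n → f≤g (suc i) (s<s i<n)))

∑-const : ∀ n x → ∑[ _ < n ] x ≡ n * x
∑-const zero    x = refl
∑-const (suc n) x = cong (_+_ x) (∑-const n x)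

∑-zero : ∀ n {f : ℕ → ℕ} → (∀ i → i < n → f i ≡ 0) → ∑< n f ≡ 0
∑-zero n f≡0 = trans (∑-cong n f≡0) (trans (∑-const n 0) (*-zeroʳ n))

∑-distrib-+ : ∀ n (f g : ℕ → ℕ) → ∑[ i < n ] (f i + g i) ≡ ∑< n f + ∑< n g
∑-distrib-+ zero    f g = refl
∑-distrib-+ (suc n) f g = trans
  (cong (_+_ (f 0 + g 0)) (∑-distrib-+ n (f ∘ suc) (g ∘ suc)))
  (interchange (f 0) (g 0) _ _)

*-distribˡ-∑ : ∀ n x (f : ℕ → ℕ) → x * ∑< n f ≡ ∑[ i < n ] (x * f i)
*-distribˡ-∑ zero    x f = *-zeroʳ x
*-distribˡ-∑ (suc n) x f =
  trans (*-distribˡ-+ x (f 0) _) (cong (_+_ (x * f 0)) (*-distribˡ-∑ n x (f ∘ suc)))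

∑-comm : ∀ m n (f : ℕ → ℕ → ℕ) →
  ∑[ i < m ] ∑[ j < n ] f i j ≡ ∑[ j < n ] ∑[ i < m ] f i j
∑-comm zero    n f = sym (∑-zero n (λ _ _ → refl))
∑-comm (suc m) n f = trans
  (cong (_+_ (∑< n (f 0))) (∑-comm m n (f ∘ suc)))
  (sym (∑-distrib-+ n (f 0) _))

∑-*-comm : ∀ m n (f : ℕ → ℕ) (g : ℕ → ℕ → ℕ) →
  ∑[ i < m ] (f i * ∑[ j < n ] g j i) ≡ ∑[ j < n ] ∑[ i < m ] (f i * g j i)
∑-*-comm m n f g = trans
  (∑-cong m (λ i _ → *-distribˡ-∑ n (f i) (λ j → g j i)))
  (∑-comm m n (λ i j → f i * g j i))

∑-split : ∀ m n (f : ℕ → ℕ) → ∑< (m + n) f ≡ ∑< m f + ∑[ i < n ] f (m + i)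
∑-split zero    n f = refl
∑-split (suc m) n f =
  trans (cong (_+_ (f 0)) (∑-split m n (f ∘ suc))) (sym (+-assoc (f 0) _ _))

∑-*-sum : ∀ n (f : ℕ → ℕ) (g : ℕ → ℕ → ℕ) as →
  ∑[ i < n ] (f i * sum (map (λ a → a * g a i) as)) ≡
  sum (map (λ a → a * ∑[ i < n ] (f i * g a i)) as)
∑-*-sum n f g []       = ∑-zero n (λ i _ → *-zeroʳ (f i))
∑-*-sum n f g (a ∷ as) = begin
  ∑[ i < n ] (f i * (a * g a i + s i))             ≡⟨ ∑-cong n (λ i _ → lemma (f i) a (g a i) (s i)) ⟩
  ∑[ i < n ] (a * (f i * g a i) + f i * s i)       ≡⟨ ∑-distrib-+ n _ _ ⟩
  (∑[ i < n ] (a * (f i * g a i))) + ∑[ i < n ] (f i * s i)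
    ≡⟨ cong₂ _+_ (sym (*-distribˡ-∑ n a _)) (∑-*-sum n f g as) ⟩
  a * (∑[ i < n ] (f i * g a i)) + sum (map (λ a → a * ∑[ i < n ] (f i * g a i)) as) ∎
  where
  open ≡-Reasoning
  s : ℕ → ℕ
  s i = sum (map (λ a → a * g a i) as)
  lemma : ∀ x a y z → x * (a * y + z) ≡ a * (x * y) + x * z
  lemma = solve-∀

gauss : ∀ n → 2 * ∑[ i < suc n ] (n ∸ i) ≡ suc n * n
gauss zero    = refl
gauss (suc n) = begin
  2 * (suc n + ∑[ i < suc n ] (n ∸ i))      ≡⟨ *-distribˡ-+ 2 (suc n) (∑[ i < suc n ] (n ∸ i)) ⟩
  2 * suc n + 2 * (∑[ i < suc n ] (n ∸ i))  ≡⟨ cong (_+_ (2 * suc n)) (gauss n) ⟩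
  2 * suc n + suc n * n                     ≡⟨ lemma n ⟩
  suc (suc n) * suc n                       ∎
  where
  open ≡-Reasoning
  lemma : ∀ n → 2 * suc n + suc n * n ≡ suc (suc n) * suc n
  lemma = solve-∀

length-filter-applyUpTo : ∀ {P : Pred ℕ 0ℓ} (P? : Decidable P) (f : ℕ → ℕ) n →
  length (filter P? (applyUpTo f n)) ≡ ∑[ i < n ] ⟦ P? (f i) ⟧
length-filter-applyUpTo P? f zero    = refl
length-filter-applyUpTo P? f (suc n) with P? (f 0)
... | yes _ = cong suc (length-filter-applyUpTo P? (f ∘ suc) n)
... | no  _ = length-filter-applyUpTo P? (f ∘ suc) n

-- The entry `x` contributes nothing, so its share `X` is still free and can be added on the left.
-- This is where `e - 1` rather than `e` comes from; the additive form avoids truncated subtraction.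
sum-map-bound : ∀ (f : ℕ → ℕ) {X x} → (∀ y → f y ≤ X) → f x ≡ 0 →
  ∀ {xs} → x ∈ˡ xs → sum (map f xs) + X ≤ length xs * X
sum-map-bound f {X} f≤X fx≡0 {_ ∷ xs} (here refl) rewrite fx≡0 =
  subst (_≤ X + length xs * X) (+-comm X _) (+-monoʳ-≤ X (sum-map≤ xs))
  where
  sum-map≤ : ∀ ys → sum (map f ys) ≤ length ys * X
  sum-map≤ []       = z≤n
  sum-map≤ (y ∷ ys) = +-mono-≤ (f≤X y) (sum-map≤ ys)
sum-map-bound f {X} f≤X fx≡0 {y ∷ ys} (there x∈) =
  subst (_≤ X + length ys * X) (sym (+-assoc (f y) _ X))
    (+-mono-≤ (f≤X y) (sum-map-bound f f≤X fx≡0 x∈))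

-- If `N` of the values are 1, the last index `j` with `f j ≢ 0` satisfies `N ≤ suc j`, so
-- `N * a ≤ suc j * a ≤ M`. The induction drops `f 0` and lowers `M` by `a`.
*-∑-bound : ∀ a n {M} (f : ℕ → ℕ) → (∀ j → f j ≤ 1) →
  (∀ j → f j ≢ 0 → suc j * a ≤ M) → a * ∑< n f ≤ M
*-∑-bound a zero    f f≤1 bound = ≤-trans (≤-reflexive (*-zeroʳ a)) z≤n
*-∑-bound a (suc n) {M} f f≤1 bound
  with f 0 | f≤1 0 | bound 0
     | *-∑-bound a n {M ∸ a} (f ∘ suc) (f≤1 ∘ suc)
         (λ j fj≢0 → m+n≤o⇒m≤o∸n (suc j * a)
           (subst (_≤ M) (+-comm a (suc j * a)) (bound (suc j) fj≢0)))
... | 0 | _ | _ | rec = ≤-trans rec (m∸n≤m M a)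
... | 1 | _ | b | rec = begin
  a * suc (∑< n (f ∘ suc))  ≡⟨ *-suc a (∑< n (f ∘ suc)) ⟩
  a + a * ∑< n (f ∘ suc)    ≤⟨ +-monoʳ-≤ a rec ⟩
  -- Since `f 0` is 1 here, `b` yields `a ≤ M`, so `M ∸ a` is a true difference.
  a + (M ∸ a)               ≡⟨ m+[n∸m]≡n (subst (_≤ M) (+-identityʳ a) (b λ ())) ⟩
  M                         ∎
  where open ≤-Reasoning
... | suc (suc _) | s≤s () | _ | _

≤-∑ : ∀ {x n} (f : ℕ → ℕ) → x ≤ n → (∀ j → j < x → f j ≡ 1) → x ≤ ∑< n f
≤-∑ f z≤n       f≡1 = z≤n
≤-∑ f (s≤s x≤n) f≡1 =
  +-mono-≤ (≤-reflexive (sym (f≡1 0 z<s)))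
           (≤-∑ (f ∘ suc) x≤n (λ j j<x → f≡1 (suc j) (s<s j<x)))

-- Shifted functions

-- With `f (n ∸ d)` the values for `n < d` would be `f 0`; the recursion makes them 0.
shift : ℕ → (ℕ → ℕ) → ℕ → ℕ
shift zero    f n       = f n
shift (suc d) f zero    = 0
shift (suc d) f (suc n) = shift d f n

shift-< : ∀ {d n} f → n < d → shift d f n ≡ 0
shift-< {suc d} {zero}  f _         = refl
shift-< {suc d} {suc n} f (s≤s n<d) = shift-< f n<d

shift-+ : ∀ d f n → shift d f (d + n) ≡ f n
shift-+ zero    f n = refl
shift-+ (suc d) f n = shift-+ d f n

shift-* : ∀ d f (g : ℕ → ℕ) n → shift d f n * g n ≡ shift d (λ k → f k * g (d + k)) n
shift-* zero    f g n       = refl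
shift-* (suc d) f g zero    = refl
shift-* (suc d) f g (suc n) = shift-* d f (g ∘ suc) n

∑-shift : ∀ d n f → ∑< (d + n) (shift d f) ≡ ∑< n f
∑-shift zero    n f = refl
∑-shift (suc d) n f = ∑-shift d n f

-- The pairs `(k , d + k)` are indexed by their lower member on the left and by their upper member
-- on the right. As `f` vanishes from `n` on, cutting either range at `n` loses no pair.
∑-*-shift : ∀ d n (f : ℕ → ℕ) → (∀ k → n ≤ k → f k ≡ 0) →
  ∑[ k < n ] (f k * f (d + k)) ≡ ∑[ k < n ] (f k * shift d f k)
∑-*-shift d n f f≡0 = begin
  ∑[ k < n ] (f k * f (d + k))                      ≡⟨ ∑-shift d n (λ k → f k * f (d + k)) ⟨
  ∑< (d + n) (shift d (λ k → f k * f (d + k)))      ≡⟨ ∑-cong (d + n) (λ k _ → sym (shift-* d f f k)) ⟩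
  ∑[ k < d + n ] (shift d f k * f k)                ≡⟨ ∑-cong (d + n) (λ k _ → *-comm (shift d f k) (f k)) ⟩
  ∑< (d + n) g                                      ≡⟨ cong (λ l → ∑< l g) (+-comm d n) ⟩
  ∑< (n + d) g                                      ≡⟨ ∑-split n d g ⟩
  (∑< n g) + ∑[ i < d ] g (n + i)
    ≡⟨ cong (_+_ (∑< n g)) (∑-zero d λ i _ → cong (_* shift d f (n + i)) (f≡0 (n + i) (m≤m+n n i))) ⟩
  ∑< n g + 0                                        ≡⟨ +-identityʳ _ ⟩
  ∑< n g                                            ∎
  where
  open ≡-Reasoning
  g : ℕ → ℕ
  g k = f k * shift d f k

-- Factorizations

-- A proof of membership in `⟨_⟩` is a tree of sums. Here the summands are grouped by generator,
-- which exposes the coefficient of each.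
data Combination : List ℕ → Pred ℕ 0ℓ where
  []  : 0 ∈ Combination []
  _∷_ : ∀ x {a as r} → r ∈ Combination as → x * a + r ∈ Combination (a ∷ as)

combination-0 : ∀ as → 0 ∈ Combination as
combination-0 []       = []
combination-0 (a ∷ as) = 0 ∷ combination-0 as

combination-+ : ∀ {as r s} → r ∈ Combination as → s ∈ Combination as → r + s ∈ Combination as
combination-+ [] [] = []
combination-+ {a ∷ as} (_∷_ x {r = r} p) (_∷_ y {r = s} q) =
  subst (_∈ Combination (a ∷ as)) (lemma x y a r s) ((x + y) ∷ combination-+ p q)
  where
  lemma : ∀ x y a r s → (x + y) * a + (r + s) ≡ x * a + r + (y * a + s)
  lemma = solve-∀

combination-∈ : ∀ {a as} → a ∈ˡ as → a ∈ Combination as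
combination-∈ {a} (here {xs = as} refl) =
  subst (_∈ Combination (a ∷ as)) (trans (+-identityʳ (1 * a)) (*-identityˡ a)) (1 ∷ combination-0 as)
combination-∈ (there a∈) = 0 ∷ combination-∈ a∈

⟨⟩⇒combination : ∀ {as n} → n ∈ ⟨ _∈ˡ as ⟩ → n ∈ Combination as
⟨⟩⇒combination (gen a∈) = combination-∈ a∈
⟨⟩⇒combination {as} ε   = combination-0 as
⟨⟩⇒combination (p ∙ q)  = combination-+ (⟨⟩⇒combination p) (⟨⟩⇒combination q)

-- The Apéry set with respect to `m`

module _ (Λ : NumericalSemigroup)
         (c : ℕ) (c≤⇒∈ : ∀ {n} → c ≤ n → n ∈ NumericalSemigroup.carrier Λ)
         (m : ℕ) .{{_ : NonZero m}} (m∈ : m ∈ NumericalSemigroup.carrier Λ) where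
  open NumericalSemigroup Λ

  private
    p W K : ℕ
    p = pred m
    W = c + p
    K = c + m

    suc-p : suc p ≡ m
    suc-p = suc-pred m

    suc-W : suc W ≡ K
    suc-W = trans (sym (+-suc c p)) (cong (_+_ c) suc-p)

    multiple∈ : ∀ {a} → a ∈ carrier → ∀ x → x * a ∈ carrier
    multiple∈ a∈ zero    = 0∈
    multiple∈ a∈ (suc x) = +-closed a∈ (multiple∈ a∈ x)

    combination⊆ : ∀ {as r} → All (_∈ carrier) as → r ∈ Combination as → r ∈ carrier
    combination⊆ []        []      = 0∈
    combination⊆ (a∈ ∷ as) (x ∷ q) = +-closed (multiple∈ a∈ x) (combination⊆ as q)

    L : ℕ → ℕ
    L n = ⟦ n ∈?carrier ⟧

  -- The guard `m ≤ n` matters: for `n < m` the difference `n ∸ m` is 0, which lies in the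
  -- semigroup.
  Apéry : Pred ℕ 0ℓ
  Apéry n = n ∈ carrier × ¬ (m ≤ n × n ∸ m ∈ carrier)

  apéry? : Decidable Apéry
  apéry? n = (n ∈?carrier) ×-dec ¬? ((m ≤? n) ×-dec ((n ∸ m) ∈?carrier))

  private
    A : ℕ → ℕ
    A n = ⟦ apéry? n ⟧

  m+∉apéry : ∀ {n} → n ∈ carrier → ¬ Apéry (m + n)
  m+∉apéry {n} n∈ (_ , ¬m+n) =
    ¬m+n (m≤m+n m n , subst (_∈ carrier) (sym (m+n∸m≡n m n)) n∈)

  apéry-< : ∀ {n} → Apéry n → n < K
  apéry-< {n} (n∈ , irr) = ≰⇒> λ K≤n → irr
    ( ≤-trans (m≤n+m m c) K≤n
    , c≤⇒∈ (m+n≤o⇒m≤o∸n c K≤n))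

  apéry-≤ : ∀ {n} → Apéry n → n ≤ W
  apéry-≤ {n} ap = ≤-pred (subst (n <_) (sym suc-W) (apéry-< ap))

  -- If `r ∸ m` were in the semigroup, adding `s` would put `r + s ∸ m` there too.
  apéry-divisor : ∀ {r s} → r ∈ carrier → s ∈ carrier → Apéry (r + s) → Apéry r
  apéry-divisor {r} {s} r∈ s∈ ap = r∈ , λ (m≤r , r∸m∈) →
    m+∉apéry (+-closed r∸m∈ s∈)
      (subst Apéry (trans (cong (_+ s) (sym (m+[n∸m]≡n m≤r))) (+-assoc m (r ∸ m) s)) ap)

  private
    A-+ : ∀ k → A (m + k) + L k ≡ L (m + k)
    A-+ k with k ∈?carrier
    ... | yes k∈ = trans (cong (_+ 1) (⟦⟧≡0 (apéry? (m + k)) (m+∉apéry k∈)))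
                         (sym (⟦⟧≡1 ((m + k) ∈?carrier) (+-closed m∈ k∈)))
    ... | no  k∉ = trans (+-identityʳ _) (⟦⟧-cong (apéry? (m + k)) ((m + k) ∈?carrier)
      proj₁ (λ m+k∈ → m+k∈ , λ (_ , k∈) → k∉ (subst (_∈ carrier) (m+n∸m≡n m k) k∈)))

    -- Each element of the semigroup is either Apéry or `m` plus an element of the semigroup, and
    -- never both.
    A+shift : ∀ n → A n + shift m L n ≡ L n
    A+shift n with <-≤-connex n m
    ... | inj₁ n<m = trans (cong (_+_ (A n)) (shift-< L n<m)) (trans (+-identityʳ (A n))
      (⟦⟧-cong (apéry? n) (n ∈?carrier) proj₁ (λ n∈ → n∈ , λ (m≤n , _) → <⇒≱ n<m m≤n)))
    ... | inj₂ m≤n with k , refl ← m≤n⇒∃[o]m+o≡n m≤n =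
      trans (cong (_+_ (A (m + k))) (shift-+ m L k)) (A-+ k)

    L≡1 : ∀ {n} → c ≤ n → L n ≡ 1
    L≡1 {n} c≤n = ⟦⟧≡1 (n ∈?carrier) (c≤⇒∈ c≤n)

    A≡0 : ∀ n → K ≤ n → A n ≡ 0
    A≡0 n K≤n = ⟦⟧≡0 (apéry? n) (λ ap → <⇒≱ (apéry-< ap) K≤n)

  -- Both sides are the sum of `g` over the semigroup below `K`. On the left it is divided by
  -- `A+shift` into the Apéry set and the translate by `m` of the part below `c`. On the right it is
  -- cut at `c`, from where on every number belongs.
  ∑-apéry : ∀ (g : ℕ → ℕ) →
    (∑[ n < K ] (A n * g n)) + (∑[ n < c ] (L n * g (m + n))) ≡
    (∑[ n < c ] (L n * g n)) + (∑[ i < m ] g (c + i))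
  ∑-apéry g = begin
    ∑A + (∑[ n < c ] (L n * g (m + n)))               ≡⟨ cong (_+_ ∑A) (∑-shift m c (λ n → L n * g (m + n))) ⟨
    ∑A + ∑< (m + c) (shift m (λ n → L n * g (m + n)))
      ≡⟨ cong (_+_ ∑A) (∑-cong (m + c) (λ n _ → sym (shift-* m L g n))) ⟩
    ∑A + (∑[ n < m + c ] (shift m L n * g n))
      ≡⟨ cong (λ k → ∑A + (∑[ n < k ] (shift m L n * g n))) (+-comm m c) ⟩
    ∑A + (∑[ n < K ] (shift m L n * g n))             ≡⟨ ∑-distrib-+ K _ _ ⟨
    ∑[ n < K ] (A n * g n + shift m L n * g n)
      ≡⟨ ∑-cong K (λ n _ → trans (sym (*-distribʳ-+ (g n) (A n) _)) (cong (_* g n) (A+shift n))) ⟩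
    ∑[ n < K ] (L n * g n)                            ≡⟨ ∑-split c m (λ n → L n * g n) ⟩
    ∑L + (∑[ i < m ] (L (c + i) * g (c + i)))
      ≡⟨ cong (_+_ ∑L) (∑-cong m λ i _ → trans (cong (_* g (c + i)) (L≡1 (m≤m+n c i))) (*-identityˡ _)) ⟩
    ∑L + (∑[ i < m ] g (c + i))                       ∎
    where
    open ≡-Reasoning
    ∑A ∑L : ℕ
    ∑A = ∑[ n < K ] (A n * g n)
    ∑L = ∑[ n < c ] (L n * g n)

  -- For a constant weight the translate and the part below `c` cancel. The case `x = 1` says that
  -- the Apéry set has `m` elements.
  ∑-apéry-const : ∀ x → ∑[ n < K ] (A n * x) ≡ m * x
  ∑-apéry-const x = +-cancelʳ-≡ (∑[ n < c ] (L n * x)) _ _ (begin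
    (∑[ n < K ] (A n * x)) + ∑L  ≡⟨ ∑-apéry (λ _ → x) ⟩
    ∑L + (∑[ _ < m ] x)          ≡⟨ cong (_+_ ∑L) (∑-const m x) ⟩
    ∑L + m * x                   ≡⟨ +-comm ∑L (m * x) ⟩
    m * x + ∑L                   ∎)
    where
    open ≡-Reasoning
    ∑L : ℕ
    ∑L = ∑[ n < c ] (L n * x)

  private
    V : ℕ
    V = ∑[ n < K ] (A n * (W ∸ n))

  -- Take the weight `W ∸ n` in `∑-apéry`. Translation by `m` lowers it by `m` for each semigroup
  -- element below `c`, and the `m` numbers from `c` to `W` have weights `p` down to 0, which
  -- `gauss` sums.
  selmer : 2 * V ≡ m * (2 * ∑< c L + p)
  selmer = begin
    2 * V                                          ≡⟨ cong (2 *_) V≡ ⟩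
    2 * (m * ∑< c L + (∑[ i < m ] (p ∸ i)))        ≡⟨ *-distribˡ-+ 2 (m * ∑< c L) _ ⟩
    2 * (m * ∑< c L) + 2 * (∑[ i < m ] (p ∸ i))
      ≡⟨ cong (_+_ (2 * (m * ∑< c L))) (subst (λ k → 2 * (∑[ i < k ] (p ∸ i)) ≡ k * p) suc-p (gauss p)) ⟩
    2 * (m * ∑< c L) + m * p                       ≡⟨ lemma m (∑< c L) p ⟩
    m * (2 * ∑< c L + p)                           ∎
    where
    open ≡-Reasoning
    lemma : ∀ m x p → 2 * (m * x) + m * p ≡ m * (2 * x + p)
    lemma = solve-∀

    ∑L : ℕ
    ∑L = ∑[ n < c ] (L n * (W ∸ (m + n)))

    W∸n : ∀ n → n < c → W ∸ n ≡ m + (W ∸ (m + n))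
    W∸n n n<c = begin
      W ∸ n              ≡⟨ m+[n∸m]≡n (m+n≤o⇒m≤o∸n m m+n≤W) ⟨
      m + (W ∸ n ∸ m)    ≡⟨ cong (_+_ m) (∸-+-assoc W n m) ⟩
      m + (W ∸ (n + m))  ≡⟨ cong (λ k → m + (W ∸ k)) (+-comm n m) ⟩
      m + (W ∸ (m + n))  ∎
      where
      m+n≤W : m + n ≤ W
      -- From `n < c` follows `m + n < K`, hence `m + n ≤ W`, and no subtraction truncates.
      m+n≤W = ≤-pred (subst (m + n <_) (trans (+-comm m c) (sym suc-W)) (+-monoʳ-< m n<c))

    V≡ : V ≡ m * ∑< c L + (∑[ i < m ] (p ∸ i))
    V≡ = +-cancelʳ-≡ ∑L _ _ (begin
      V + ∑L                                                        ≡⟨ ∑-apéry (W ∸_) ⟩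
      (∑[ n < c ] (L n * (W ∸ n))) + (∑[ i < m ] (W ∸ (c + i)))
        ≡⟨ cong₂ _+_
             (∑-cong c λ n n<c → trans (cong (L n *_) (W∸n n n<c))
               (trans (*-distribˡ-+ (L n) m _) (cong (_+ L n * (W ∸ (m + n))) (*-comm (L n) m))))
             (∑-cong m λ i _ → [m+n]∸[m+o]≡n∸o c p i) ⟩
      (∑[ n < c ] (m * L n + L n * (W ∸ (m + n)))) + ∑p
        ≡⟨ cong (_+ ∑p) (∑-distrib-+ c _ _) ⟩
      (∑[ n < c ] (m * L n)) + ∑L + ∑p
        ≡⟨ cong (λ x → x + ∑L + ∑p) (sym (*-distribˡ-∑ c m L)) ⟩
      m * ∑< c L + ∑L + ∑p                                          ≡⟨ rearrange (m * ∑< c L) ∑L ∑p ⟩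
      m * ∑< c L + ∑p + ∑L                                          ∎)
      where
      ∑p : ℕ
      ∑p = ∑[ i < m ] (p ∸ i)
      rearrange : ∀ x y z → x + y + z ≡ x + z + y
      rearrange = solve-∀

  -- Counting pairs of Apéry elements that differ by multiples of a generator

  private
    -- The index `j` stands for `j + 1` steps of length `a`, up from `n` or down from `n`. For
    -- `a > 0` the range `K` catches every pair, since Apéry elements are below `K`; for `a = 0` the
    -- factor `a` in the bounds removes the count.
    above below : ℕ → ℕ → ℕ
    above a n = ∑[ j < K ] A (suc j * a + n)
    below a n = ∑[ j < K ] shift (suc j * a) A n

    pairs : ℕ → ℕ
    pairs a = ∑[ n < K ] (A n * below a n)

    -- Double counting: exchanging the sums fixes the distance `suc j * a`, and for a fixed distance
    -- `∑-*-shift` passes from upper to lower members.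
    pairs≡∑above : ∀ a → pairs a ≡ ∑[ n < K ] (A n * above a n)
    pairs≡∑above a = begin
      ∑[ n < K ] (A n * below a n)                            ≡⟨ ∑-*-comm K K A _ ⟩
      ∑[ j < K ] ∑[ n < K ] (A n * shift (suc j * a) A n)
        ≡⟨ ∑-cong K (λ j _ → sym (∑-*-shift (suc j * a) K A A≡0)) ⟩
      ∑[ j < K ] ∑[ n < K ] (A n * A (suc j * a + n))         ≡⟨ ∑-*-comm K K A _ ⟨
      ∑[ n < K ] (A n * above a n)                            ∎
      where open ≡-Reasoning

    above-bound : ∀ a n → a * above a n ≤ W ∸ n
    above-bound a n = *-∑-bound a K (λ j → A (suc j * a + n))
      (λ j → ⟦⟧≤1 (apéry? (suc j * a + n)))
      (λ j Aj≢0 → m+n≤o⇒m≤o∸n (suc j * a) (apéry-≤ (⟦⟧≢0 (apéry? (suc j * a + n)) Aj≢0)))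

    pairs-bound : ∀ a → a * pairs a ≤ V
    pairs-bound a = begin
      a * pairs a                                   ≡⟨ cong (a *_) (pairs≡∑above a) ⟩
      a * (∑[ n < K ] (A n * above a n))        ≡⟨ *-distribˡ-∑ K a _ ⟩
      ∑[ n < K ] (a * (A n * above a n))        ≡⟨ ∑-cong K (λ n _ → x∙yz≈y∙xz a (A n) (above a n)) ⟩
      ∑[ n < K ] (A n * (a * above a n))        ≤⟨ ∑-mono K (λ n _ → *-monoʳ-≤ (A n) (above-bound a n)) ⟩
      V                                         ∎
      where
      open ≤-Reasoning

    -- Taking one `m` away from `suc j * m + n` leaves `j * m + n`, still in the semigroup, so no
    -- such sum is Apéry.
    pairs-multiplicity : pairs m ≡ 0
    pairs-multiplicity = trans (pairs≡∑above m) (∑-zero K (λ n _ → trans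
      (⟦⟧-*-congʳ (apéry? n) (λ (n∈ , _) → ∑-zero K (λ j _ → ⟦⟧≡0 (apéry? (suc j * m + n)) (λ ap →
        m+∉apéry (+-closed (multiple∈ m∈ j) n∈) (subst Apéry (+-assoc m (j * m) n) ap)))))
      (*-zeroʳ (A n))))

    -- Removing `1, ..., x` copies of `a` leaves divisors of the Apéry element, all of them Apéry:
    -- these are `x` lower partners.
    x*a≤a*below : ∀ x a {r} → r ∈ carrier → a ∈ carrier → Apéry (x * a + r) →
      x * a ≤ a * below a (x * a + r)
    -- With `a = 0` the range `K` may hold fewer than `x` indices, but both sides are 0.
    x*a≤a*below x zero _ _ _ = ≤-reflexive (*-zeroʳ x)
    x*a≤a*below x a@(suc _) {r} r∈ a∈ ap = subst (_≤ a * below a n) (*-comm a x)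
      (*-monoʳ-≤ a (≤-∑ _ x≤K shift≡1))
      where
      n : ℕ
      n = x * a + r

      x≤K : x ≤ K
      x≤K = ≤-trans (m≤m*n x a) (≤-trans (m≤m+n (x * a) r) (<⇒≤ (apéry-< ap)))

      shift≡1 : ∀ j → j < x → shift (suc j * a) A n ≡ 1
      -- `y` is the number of copies of `a` that remain after `suc j` of them are removed.
      shift≡1 j j<x with y , refl ← m≤n⇒∃[o]m+o≡n j<x = begin
        shift (suc j * a) A ((suc j + y) * a + r)      ≡⟨ cong (shift (suc j * a) A) n≡ ⟩
        shift (suc j * a) A (suc j * a + (y * a + r))  ≡⟨ shift-+ (suc j * a) A (y * a + r) ⟩
        A (y * a + r)
          ≡⟨ ⟦⟧≡1 (apéry? (y * a + r)) (apéry-divisor (+-closed (multiple∈ a∈ y) r∈) (multiple∈ a∈ (suc j))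
               (subst Apéry (trans n≡ (+-comm (suc j * a) _)) ap)) ⟩
        1                                              ∎
        where
        open ≡-Reasoning
        n≡ : (suc j + y) * a + r ≡ suc j * a + (y * a + r)
        n≡ = trans (cong (_+ r) (*-distribʳ-+ a (suc j) y)) (+-assoc (suc j * a) (y * a) r)

    -- `s` collects the part of the factorization already treated, so that the Apéry element `n`
    -- stays the same while `r` shrinks along the list.
    combination-≤-below : ∀ {as r s n} → All (_∈ carrier) as → r ∈ Combination as → s ∈ carrier →
      r + s ≡ n → Apéry n → r ≤ sum (map (λ a → a * below a n) as)
    combination-≤-below [] [] s∈ eq ap = z≤n
    combination-≤-below {s = s} (a∈ ∷ as∈) (_∷_ x {a} {r = r} q) s∈ refl ap = +-mono-≤
      (subst (λ n → x * a ≤ a * below a n) (sym (+-assoc (x * a) r s))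
        (x*a≤a*below x a (+-closed (combination⊆ as∈ q) s∈) a∈
          (subst Apéry (+-assoc (x * a) r s) ap)))
      (combination-≤-below as∈ q (+-closed (multiple∈ a∈ x) s∈)
        (trans (sym (+-assoc r (x * a) s)) (cong (_+ s) (+-comm r (x * a)))) ap)

  -- Write `W` as `n + (W ∸ n)` over the Apéry set: the second terms sum to `V`, and factoring each
  -- `n` bounds the sum of the first terms by the pair counts.
  apéry-mean : ∀ {gs} → (_∈ˡ gs) Generates Λ → m ∈ˡ gs → m * W ≤ length gs * V
  apéry-mean {gs} (⟨gs⟩⊆ , ⊆⟨gs⟩) m∈gs = begin
    m * W                                   ≡⟨ ∑-apéry-const W ⟨
    ∑[ n < K ] (A n * W)
      ≡⟨ ∑-cong K (λ n _ → trans (⟦⟧-*-congʳ (apéry? n) (λ ap → sym (m+[n∸m]≡n (apéry-≤ ap)))) (*-distribˡ-+ (A n) n _)) ⟩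
    ∑[ n < K ] (A n * n + A n * (W ∸ n))    ≡⟨ ∑-distrib-+ K _ _ ⟩
    (∑[ n < K ] (A n * n)) + V
      ≤⟨ +-monoˡ-≤ V (∑-mono K (λ n _ → ⟦⟧-*-monoʳ-≤ (apéry? n) (apéry≤ n))) ⟩
    (∑[ n < K ] (A n * sum (map (λ a → a * below a n) gs))) + V
      ≡⟨ cong (_+ V) (∑-*-sum K A below gs) ⟩
    sum (map (λ a → a * pairs a) gs) + V
      ≤⟨ sum-map-bound (λ a → a * pairs a) pairs-bound (trans (cong (m *_) pairs-multiplicity) (*-zeroʳ m)) m∈gs ⟩
    length gs * V                           ∎
    where
    open ≤-Reasoning
    apéry≤ : ∀ n → Apéry n → n ≤ sum (map (λ a → a * below a n) gs)
    apéry≤ n ap = combination-≤-below (All.tabulate (⟨gs⟩⊆ ∘ gen))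
      (⟨⟩⇒combination (⊆⟨gs⟩ (proj₁ ap))) 0∈ (+-identityʳ n) ap

  -- This is the theorem multiplied by `2 * e` and freed of subtraction: `selmer` turns `V` into the
  -- count below `c`, and the common factor `m` cancels.
  conductor-bound : ∀ {gs} → (_∈ˡ gs) Generates Λ → m ∈ˡ gs →
    2 * (c + p) ≤ length gs * (2 * ∑< c L + p)
  conductor-bound {gs} gens m∈gs = *-cancelˡ-≤ m (begin
    m * (2 * W)                 ≡⟨ x∙yz≈y∙xz m 2 W ⟩
    2 * (m * W)                 ≤⟨ *-monoʳ-≤ 2 (apéry-mean gens m∈gs) ⟩
    2 * (e * V)                 ≡⟨ x∙yz≈y∙xz 2 e V ⟩
    e * (2 * V)                 ≡⟨ cong (e *_) selmer ⟩
    e * (m * (2 * ∑< c L + p))  ≡⟨ x∙yz≈y∙xz e m _ ⟩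
    m * (e * (2 * ∑< c L + p))  ∎)
    where
    open ≤-Reasoning
    e : ℕ
    e = length gs

-- From natural numbers to rationals

ℚ-bound : ∀ c c′ m e .{{_ : NonZero m}} .{{_ : NonZero e}} .{{_ : NonZero (2 * e)}} →
  2 * (c + pred m) ≤ e * (2 * c′ + pred m) →
  (+ c′) / 1 ≥ (+ c) / e - ((+ m ℤ.- + 1) ℤ.* (+ e ℤ.- + 2)) / (2 * e)
ℚ-bound c c′ (suc p) e@(suc k) bound = ℚ.toℚᵘ-cancel-≤ (begin
  toℚᵘ (+ c / e - X / (2 * e))                ≃⟨ ℚ.toℚᵘ-homo-+ (+ c / e) _ ⟩
  toℚᵘ (+ c / e) ℚᵘ.+ toℚᵘ (ℚ.- (X / (2 * e)))
    ≃⟨ ℚᵘ.+-cong (ℚ.toℚᵘ-fromℚᵘ (+ c ℚᵘ./ e))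
         (ℚᵘ.≃-trans (ℚ.toℚᵘ-homo‿- (X / (2 * e))) (ℚᵘ.-‿cong (ℚ.toℚᵘ-fromℚᵘ (X ℚᵘ./ (2 * e))))) ⟩
  + c ℚᵘ./ e ℚᵘ.- X ℚᵘ./ (2 * e)              ≤⟨ ℚᵘ.*≤* cross ⟩
  + c′ ℚᵘ./ 1                                 ≃⟨ ℚ.toℚᵘ-fromℚᵘ (+ c′ ℚᵘ./ 1) ⟨
  toℚᵘ (+ c′ / 1)                             ∎)
  where
  open ℚᵘ.≤-Reasoning
  X : ℤ.ℤ
  X = + p ℤ.* (+ e ℤ.- + 2)

  -- The unnormalised difference has denominator `e * (2 * e)`, so this is `bound` multiplied by
  -- `e`, with `Y` subtracted on both sides. Integers are essential, as `e - 2` is negative for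
  -- `e = 1`.
  cross : (+ c ℤ.* + (2 * e) ℤ.+ ℤ.- X ℤ.* + e) ℤ.* + 1 ℤ.≤ + c′ ℤ.* + (e * (2 * e))
  cross = ℤR.begin
    (+ c ℤ.* + (2 * e) ℤ.+ ℤ.- X ℤ.* + e) ℤ.* + 1
      ℤR.≡⟨ cong (λ x → (+ c ℤ.* x ℤ.+ ℤ.- X ℤ.* + e) ℤ.* + 1) (ℤ.pos-* 2 e) ⟩
    (+ c ℤ.* (+ 2 ℤ.* + e) ℤ.+ ℤ.- X ℤ.* + e) ℤ.* + 1
      ℤR.≡⟨ expandˡ (+ c) (+ p) (+ e) ⟩
    + e ℤ.* (+ 2 ℤ.* (+ c ℤ.+ + p)) ℤ.- Y
      ℤR.≡⟨ cong (λ x → + e ℤ.* x ℤ.- Y) (ℤ.pos-* 2 (c + p)) ⟨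
    + e ℤ.* + (2 * (c + p)) ℤ.- Y
      ℤR.≤⟨ ℤ.+-monoˡ-≤ (ℤ.- Y) (ℤ.*-monoˡ-≤-nonNeg (+ e) (ℤ.+≤+ bound)) ⟩
    + e ℤ.* + (e * (2 * c′ + p)) ℤ.- Y
      ℤR.≡⟨ cong (λ x → + e ℤ.* x ℤ.- Y) (trans (ℤ.pos-* e _)
              (cong (λ x → + e ℤ.* (x ℤ.+ + p)) (ℤ.pos-* 2 c′))) ⟩
    + e ℤ.* (+ e ℤ.* (+ 2 ℤ.* + c′ ℤ.+ + p)) ℤ.- Y
      ℤR.≡⟨ expandʳ (+ c′) (+ p) (+ e) ⟩
    + c′ ℤ.* (+ e ℤ.* (+ 2 ℤ.* + e))
      ℤR.≡⟨ cong (+ c′ ℤ.*_) (trans (ℤ.pos-* e (2 * e)) (cong (+ e ℤ.*_) (ℤ.pos-* 2 e))) ⟨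
    + c′ ℤ.* + (e * (2 * e)) ℤR.∎
    where
    module ℤR = ℤ.≤-Reasoning
    Y : ℤ.ℤ
    Y = + e ℤ.* (+ e ℤ.* + p)
    expandˡ : ∀ c p e →
      (c ℤ.* (+ 2 ℤ.* e) ℤ.+ ℤ.- (p ℤ.* (e ℤ.- + 2)) ℤ.* e) ℤ.* + 1 ≡
      e ℤ.* (+ 2 ℤ.* (c ℤ.+ p)) ℤ.- e ℤ.* (e ℤ.* p)
    expandˡ = ℤ-Solver.solve-∀
    expandʳ : ∀ c p e →
      e ℤ.* (e ℤ.* (+ 2 ℤ.* c ℤ.+ p)) ℤ.- e ℤ.* (e ℤ.* p) ≡ c ℤ.* (e ℤ.* (+ 2 ℤ.* e))
    expandʳ = ℤ-Solver.solve-∀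

theorem1 : ∀ (Λ : NumericalSemigroup) →
    let c = conductor Λ
        e = embeddingDimension Λ
        m = multiplicity Λ
        instance
          e≢0   = embeddingDimension-nonZero Λ
          2*e≢0 = 2*embeddingDimension-nonZero Λ
    in (+ c′ Λ) / 1 ≥ (+ c) / e - ((+ m ℤ.- + 1) ℤ.* (+ e ℤ.- + 2)) / (2 ℕ.* e)
theorem1 Λ = ℚ-bound (conductor Λ) (c′ Λ) m (embeddingDimension Λ)
  {{m≢0}} {{embeddingDimension-nonZero Λ}} {{2*embeddingDimension-nonZero Λ}}
  (subst (λ x → 2 * (conductor Λ + pred m) ≤ embeddingDimension Λ * (2 * x + pred m))
    (sym (length-filter-applyUpTo (Λ ∈?carrier) (λ n → n) (conductor Λ)))
    (conductor-bound Λ (conductor Λ) (conductor≤⇒∈ Λ) m {{m≢0}} m∈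
      (irreducibles-generate Λ) m∈gs))
  where
  open NumericalSemigroup using (carrier; _∈?carrier)
  m : ℕ
  m = multiplicity Λ
  m∈ : m ∈ carrier Λ
  m∈ = proj₁ (proj₁ (proj₂ (leastPositive Λ)))
  0≢m : 0 ≢ m
  0≢m = proj₂ (proj₁ (proj₂ (leastPositive Λ)))
  m≢0 : NonZero m
  m≢0 = ≢-nonZero (≢-sym 0≢m)
  -- A nonzero proper summand of `m` in the semigroup would be a smaller positive element, so `m` is
  -- irreducible.
  m∈gs : m ∈ˡ irreducibles Λ
  m∈gs = proj₂ (irreducibles-spec Λ)
    ( m∈
    , ≢-sym 0≢m
    , λ (_ , a<m , a∈ , a≢0 , _) → <⇒≱ a<m (proj₂ (proj₂ (leastPositive Λ)) (a∈ , ≢-sym a≢0)))
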